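{- For every integer $k\geq 2$, $$\operatorname{spex}_{\kappa}(2k,K_3;k)=k-1.$$ Among the admissible graphs (triangle-free graphs $G$ of order $2k$ with $\kappa(\overline{G})\geq k$), the equality $\rho(G)=k-1$ holds precisely for those containing a $(k-1)$-regular connected component. In particular, $B_{2k,k}=K_{k,k}-M_k$ is extremal, i.e. it is admissible and $\rho(B_{2k,k})=k-1$.
   Context: All graphs are finite, simple and undirected. $\rho(G)$ denotes the largest eigenvalue of the adjacency matrix of $G$, and $\overline{G}$ is the complement of $G$. The vertex-connectivity $\kappa(H)$ is the minimum number of vertices whose deletion disconnects $H$ or leaves a single vertex; in particular $\kappa(K_n)=n-1$. Define $$\operatorname{spex}_{\kappa}(n,K_3;k):=\max\{\rho(G): |V(G)|=n,\ G\text{ is triangle-free},\ \kappa(\overline{G})\geq k\}.$$ $K_{k,k}-M_k$ is the graph obtained from the complete bipartite graph $K_{k,k}$ by deleting the edges of a perfect matching $M_k$ (a matching of size $k$). -}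

module Defs where

open import Level using (Level; 0ℓ; _⊔_) renaming (suc to lsuc)
open import Algebra.Apartness.Bundles using (HeytingField; HeytingCommutativeRing)
open import Algebra.Bundles using (CommutativeRing)
open import Data.Bool.Base using (if_then_else_)
open import Data.Fin.Base using (Fin; remQuot)
open import Data.Fin.Properties using () renaming (_≟_ to _≟ᶠ_)
open import Data.Fin.Subset using (Subset; Nonempty; _∈_; _∉_; _∩_; ∁; ∣_∣)
open import Data.Nat.Base as ℕ using (ℕ)
open import Data.Product.Base using (∃; ∃₂; _×_; _,_; proj₁; proj₂)
open import Data.Sum.Base using (_⊎_)
open import Data.Vec.Base using (tabulate)
open import Data.Vec.Functional using (Vector)
open import Function.Base using (_∘_)
open import Function.Bundles using (_⇔_)
open import Relation.Binary.Construct.Closure.ReflexiveTransitive using (Star)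
open import Relation.Binary.Core using (Rel)
open import Relation.Binary.Definitions using (Decidable; Irreflexive; Symmetric)
open import Relation.Binary.PropositionalEquality using (_≡_; _≢_; refl; sym)
open import Relation.Binary.Structures using (IsStrictPartialOrder)
open import Relation.Nullary.Decidable using (does; ¬?; _×-dec_)
open import Relation.Nullary.Negation using (¬_)
import Algebra.Properties.Semiring.Mult as Mult
import Algebra.Properties.Semiring.Sum as Sum

private
  variable
    n : ℕ

------------------------------------------------------------------------
-- Real numbers

-- The standard library has no real numbers, so they are given by their
-- axioms: an Archimedean, Cauchy-complete ordered field.  Classically ℝ
-- is, up to isomorphism, the only model.  The axioms are phrased with
-- apartness and a strict order that is not assumed decidable, so that
-- the usual constructive reals satisfy them too.

record RealNumbers c ℓ₁ ℓ₂ : Set (lsuc (c ⊔ ℓ₁ ⊔ ℓ₂)) where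
  field
    heytingField : HeytingField c ℓ₁ ℓ₂

  open HeytingField heytingField public

  commutativeRing : CommutativeRing c ℓ₁
  commutativeRing = HeytingCommutativeRing.commutativeRing heytingCommutativeRing

  open Sum (CommutativeRing.semiring commutativeRing) public using (sum)
  open Mult (CommutativeRing.semiring commutativeRing) public
    using () renaming (_×_ to infixr 8 _·ℕ_)

  fromℕ : ℕ → Carrier
  fromℕ m = m ·ℕ 1#

  infix 4 _<_ _≤_
  field
    _<_                  : Rel Carrier ℓ₂
    isStrictPartialOrder : IsStrictPartialOrder _≈_ _<_
    #⇔<⊎>                : ∀ x y → (x # y) ⇔ (x < y ⊎ y < x)
    +-monoˡ-<            : ∀ {x y} z → x < y → x + z < y + z
    *-pos                : ∀ {x y} → 0# < x → 0# < y → 0# < x * y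
    archimedean          : ∀ x → ∃ λ m → x < fromℕ m

  _≤_ : Rel Carrier ℓ₂
  x ≤ y = ¬ (y < x)

  ∣_-_∣<_ : Carrier → Carrier → Carrier → Set ℓ₂
  ∣ x - y ∣< ε = (x - y < ε) × (y - x < ε)

  Cauchy : (ℕ → Carrier) → Set (c ⊔ ℓ₂)
  Cauchy s = ∀ ε → 0# < ε →
    ∃ λ N → ∀ i j → N ℕ.≤ i → N ℕ.≤ j → ∣ s i - s j ∣< ε

  _ConvergesTo_ : (ℕ → Carrier) → Carrier → Set (c ⊔ ℓ₂)
  s ConvergesTo x = ∀ ε → 0# < ε →
    ∃ λ N → ∀ i → N ℕ.≤ i → ∣ s i - x ∣< ε

  field
    complete : ∀ s → Cauchy s → ∃ λ x → s ConvergesTo x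

------------------------------------------------------------------------
-- Graphs

record Graph (n : ℕ) : Set₁ where
  field
    Adj    : Rel (Fin n) 0ℓ
    adj?   : Decidable Adj
    symm   : Symmetric Adj
    irrefl : Irreflexive _≡_ Adj

open Graph public

complement : Graph n → Graph n
complement G = record
  { Adj    = λ u v → u ≢ v × ¬ Adj G u v
  ; adj?   = λ u v → ¬? (u ≟ᶠ v) ×-dec ¬? (adj? G u v)
  ; symm   = λ (u≢v , ¬uv) → u≢v ∘ sym , ¬uv ∘ symm G
  ; irrefl = λ u≡v (u≢v , _) → u≢v u≡v
  }

_∖ᴱ_ : Graph n → Graph n → Graph n
G ∖ᴱ M = record
  { Adj    = λ u v → Adj G u v × ¬ Adj M u v
  ; adj?   = λ u v → adj? G u v ×-dec ¬? (adj? M u v)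
  ; symm   = λ (uv , ¬uv) → symm G uv , ¬uv ∘ symm M
  ; irrefl = λ u≡v (uv , _) → irrefl G u≡v uv
  }

TriangleFree : Graph n → Set
TriangleFree G = ∀ u v w → ¬ (Adj G u v × Adj G v w × Adj G u w)

neighbours : Graph n → Fin n → Subset n
neighbours G u = tabulate λ v → does (adj? G u v)

IsComponent : Graph n → Subset n → Set
IsComponent G C =
  Nonempty C × (∀ u v → u ∈ C → (v ∈ C) ⇔ Star (Adj G) u v)

HasRegularComponent : Graph n → ℕ → Set
HasRegularComponent G d =
  ∃ λ C → IsComponent G C × (∀ v → v ∈ C → ∣ C ∩ neighbours G v ∣ ≡ d)

------------------------------------------------------------------------
-- Vertex-connectivity

-- Adjacency in H − S; the vertices of H − S are those outside S.
AdjDel : Graph n → Subset n → Rel (Fin n) 0ℓ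
AdjDel H S u v = u ∉ S × v ∉ S × Adj H u v

Disconnects : Graph n → Subset n → Set
Disconnects H S = ∃₂ λ u v → u ∉ S × v ∉ S × ¬ Star (AdjDel H S) u v

LeavesSingleVertex : Subset n → Set
LeavesSingleVertex S = ∣ ∁ S ∣ ≡ 1

IsVertexConnectivity : Graph n → ℕ → Set
IsVertexConnectivity H m =
    (∃ λ S → Separates S × ∣ S ∣ ≡ m)
  × (∀ S → Separates S → m ℕ.≤ ∣ S ∣)
  where
  Separates = λ S → Disconnects H S ⊎ LeavesSingleVertex S

κ[_]≥_ : Graph n → ℕ → Set
κ[ H ]≥ k = ∃ λ m → IsVertexConnectivity H m × k ℕ.≤ m

Admissible : ℕ → Graph n → Set
Admissible k G = TriangleFree G × κ[ complement G ]≥ k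

------------------------------------------------------------------------
-- K_{k,k} minus a perfect matching

-- Vertex number a * k + i of 2 * k is the i-th vertex of part a.
part : ∀ k → Fin (2 ℕ.* k) → Fin 2
part k = proj₁ ∘ remQuot {2} k

index : ∀ k → Fin (2 ℕ.* k) → Fin k
index k = proj₂ ∘ remQuot {2} k

completeBipartite : ∀ k → Graph (2 ℕ.* k)
completeBipartite k = record
  { Adj    = λ u v → part k u ≢ part k v
  ; adj?   = λ u v → ¬? (part k u ≟ᶠ part k v)
  ; symm   = λ u≢v → u≢v ∘ sym
  ; irrefl = λ { refl u≢u → u≢u refl }
  }

perfectMatching : ∀ k → Graph (2 ℕ.* k)
perfectMatching k = record
  { Adj    = λ u v → part k u ≢ part k v × index k u ≡ index k v
  ; adj?   = λ u v → ¬? (part k u ≟ᶠ part k v) ×-dec (index k u ≟ᶠ index k v)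
  ; symm   = λ (u≢v , i≡j) → u≢v ∘ sym , sym i≡j
  ; irrefl = λ { refl (u≢u , _) → u≢u refl }
  }

B : ∀ k → Graph (2 ℕ.* k)
B k = completeBipartite k ∖ᴱ perfectMatching k

------------------------------------------------------------------------
-- Spectra

module Spectral {c ℓ₁ ℓ₂} (ℝ : RealNumbers c ℓ₁ ℓ₂) where
  open RealNumbers ℝ

  Matrix : ℕ → Set c
  Matrix n = Fin n → Fin n → Carrier

  adjacencyMatrix : Graph n → Matrix n
  adjacencyMatrix G u v = if does (adj? G u v) then 1# else 0#

  _·_ : Matrix n → Vector Carrier n → Vector Carrier n
  (A · x) i = sum λ j → A i j * x j

  IsEigenvalue : Matrix n → Carrier → Set (c ⊔ ℓ₁ ⊔ ℓ₂)
  IsEigenvalue A μ =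
    ∃ λ x → (∃ λ i → x i # 0#) × (∀ i → (A · x) i ≈ μ * x i)

  IsMaximum : ∀ {p} → (Carrier → Set p) → Carrier → Set (c ⊔ ℓ₂ ⊔ p)
  IsMaximum P r = P r × (∀ s → P s → s ≤ r)

  -- ρ(G) = r and spex_κ(n, K₃; k) = r are relations between the graph,
  -- respectively the parameters, and the real number r.
  ρ[_]≔_ : Graph n → Carrier → Set (c ⊔ ℓ₁ ⊔ ℓ₂)
  ρ[ G ]≔ r = IsMaximum (IsEigenvalue (adjacencyMatrix G)) r

  spexκ[_,K₃,_]≔_ : ℕ → ℕ → Carrier → Set (lsuc 0ℓ ⊔ c ⊔ ℓ₁ ⊔ ℓ₂)
  spexκ[ n ,K₃, k ]≔ r =
    IsMaximum (λ s → ∃ λ (G : Graph n) → Admissible k G × ρ[ G ]≔ s) r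

{-# OPTIONS --safe #-}
-- If κ(Ḡ) ≥ k, deleting the Ḡ-neighbourhood of a vertex shows that Ḡ has
-- minimum degree at least k, so G has maximum degree at most d = k − 1.
-- For an eigenvector x of an eigenvalue s of such a graph,
--
--   Σᵢ ( 2 (s − d) xᵢ² + 2 (d − deg i) xᵢ² + Σⱼ Aᵢⱼ (xᵢ − xⱼ)² ) = 0.
--
-- When s ≥ d every term is nonnegative, hence zero.  So s > d is impossible,
-- and for s = d the vector x is constant on components and deg i = d wherever
-- xᵢ ≠ 0, which makes the component of such an i regular.  Conversely the
-- indicator of a d-regular component is an eigenvector for d.
-- The identity needs no absolute values and no decidable order on ℝ.
module Submission where

open import Defs
open import Data.Fin.Base using (Fin; zero; suc)
open import Data.Fin.Subset using (Subset; Nonempty; _∈_; _∉_; _∩_; ⊤; ∣_∣)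
open import Data.Fin.Subset.Properties using (_∈?_; ∈⊤)
open import Data.Nat.Base using (ℕ; zero; suc; _≤_; _∸_)
open import Data.Product.Base using (∃; _×_; _,_; proj₁; proj₂)
open import Data.Sum.Base using (_⊎_; inj₁; inj₂)
open import Data.Vec.Properties using (lookup∘tabulate; lookup⇒[]=; []=⇒lookup)
open import Function.Base using (_∘_)
open import Function.Bundles using (_⇔_; mk⇔; module Equivalence)
open import Relation.Binary.Construct.Closure.ReflexiveTransitive using (Star; ε; _◅_)
open import Relation.Nullary.Decidable using (yes; no; does; dec-true)
open import Relation.Nullary.Negation using (¬_; contradiction)

-- Neighbourhoods, closed sets and components.

module GraphTheory where
  open import Data.Bool.Base using (true)
  open import Data.Fin.Base using (combine; punchIn; opposite)
  open import Data.Fin.Properties using (any?; all?; ¬∀⟶∃¬; suc-injective; 0≢1+n;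
    combine-injectiveʳ; remQuot-combine; punchIn-injective; punchInᵢ≢i)
    renaming (_≟_ to _≟ᶠ_)
  open import Data.Fin.Subset using (_∪_; _-_; _⊆_; _⊃_; ⁅_⁆)
  open import Data.Fin.Subset.Properties using (x∈⁅x⁆; x∈⁅y⁆⇒x≡y; ∣⁅x⁆∣≡1; p⊆p∪q; x∈p∪q⁺;
    x∈p∪q⁻; p⊆q⇒∣p∣≤∣q∣; p⊂q⇒∣p∣<∣q∣; x∈∁p⇒x∉p; x∉p⇒x∈∁p; ∣∁p∣≡n∸∣p∣; x∈p∧x≢y⇒x∈p-y;
    x∈p⇒∣p-x∣<∣p∣; ⊆-antisym; p∩q⊆q; x∈p∩q⁺; ∣p∣≤n)
  open import Data.Fin.Subset.Induction using (Acc; acc; ⊃-wellFounded)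
  open import Data.Nat.Base using (_<_; _+_; _*_; z≤n; s≤s; s≤s⁻¹)
  open import Data.Nat.Properties using (≤-trans; ≤-reflexive; ≤-antisym; ≤-<-connex; <⇒≱;
    <-≤-trans; ≤-<-trans; <⇒≤; m≤n+m∸n; ∸-monoʳ-≤; +-monoʳ-≤; m+n∸m≡n; +-comm; +-identityʳ;
    m≤o∸n⇒m+n≤o; m+n≤o⇒m≤o∸n)
  open import Function.Definitions using (Injective)
  open import Relation.Binary.Construct.Closure.ReflexiveTransitive using (_◅◅_; reverse)
  open import Relation.Binary.PropositionalEquality
    using (_≡_; _≢_; refl; sym; trans; cong; subst)
  open import Relation.Nullary.Decidable using (Dec; ¬?; _×-dec_; decidable-stable)

  private
    variable
      m n k : ℕ

  does⇒ : ∀ {a} {A : Set a} (a? : Dec A) → does a? ≡ true → A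
  does⇒ (yes a) refl = a

  -- Induction on `m`: taking `f zero` out of `S` lowers its size, and injectivity keeps the other
  -- values inside.
  injection⇒≤∣∣ : (S : Subset n) (f : Fin m → Fin n) → Injective _≡_ _≡_ f → (∀ i → f i ∈ S) → m ≤ ∣ S ∣
  injection⇒≤∣∣ {m = zero}  S f f-inj f∈S = z≤n
  injection⇒≤∣∣ {m = suc m} S f f-inj f∈S = ≤-trans
    (s≤s (injection⇒≤∣∣ (S - f zero) (f ∘ suc) (suc-injective ∘ f-inj)
      λ i → x∈p∧x≢y⇒x∈p-y (f∈S (suc i)) λ eq → 0≢1+n (sym (f-inj eq))))
    (x∈p⇒∣p-x∣<∣p∣ (f∈S zero))

  module _ (G : Graph n) where

    ∈-neighbours⁺ : ∀ {u v} → Adj G u v → v ∈ neighbours G u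
    ∈-neighbours⁺ {u} {v} uv =
      lookup⇒[]= v _ (trans (lookup∘tabulate _ v) (dec-true (adj? G u v) uv))

    ∈-neighbours⁻ : ∀ {u v} → v ∈ neighbours G u → Adj G u v
    ∈-neighbours⁻ {u} {v} v∈ =
      does⇒ (adj? G u v) (trans (sym (lookup∘tabulate _ v)) ([]=⇒lookup v∈))

    Closed : Subset n → Set
    Closed C = ∀ {u v} → u ∈ C → Adj G u v → v ∈ C

    closed-star : ∀ {C u v} → Closed C → u ∈ C → Star (Adj G) u v → v ∈ C
    closed-star closed u∈C ε          = u∈C
    closed-star closed u∈C (uw ◅ wv) = closed-star closed (closed u∈C uw) wv

    closed⇒∩-neighbours : ∀ {C u} → Closed C → u ∈ C → C ∩ neighbours G u ≡ neighbours G u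
    closed⇒∩-neighbours {C} {u} closed u∈C = ⊆-antisym (p∩q⊆q C (neighbours G u))
      λ v∈N → x∈p∩q⁺ (closed u∈C (∈-neighbours⁻ v∈N) , v∈N)

    component-closed : ∀ {C} → IsComponent G C → Closed C
    component-closed (_ , comp) {u} {v} u∈C uv = Equivalence.from (comp u v u∈C) (uv ◅ ε)

    private
      -- While some edge leaves `S`, its far end is added. The recursion is well-founded because the
      -- sets strictly grow, and every added vertex stays reachable from `i`.
      saturate : ∀ {i} S → Acc _⊃_ S → (∀ {v} → v ∈ S → Star (Adj G) i v) →
                 ∃ λ C → S ⊆ C × Closed C × (∀ {v} → v ∈ C → Star (Adj G) i v)
      saturate S (acc rec) reach
        with any? (λ u → any? (λ v → (u ∈? S) ×-dec (adj? G u v ×-dec ¬? (v ∈? S))))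
      ... | no  none = S , (λ v∈S → v∈S) ,
            (λ {u} {v} u∈S uv → decidable-stable (v ∈? S) λ v∉S → none (u , v , u∈S , uv , v∉S)) ,
            reach
      ... | yes (u , v , u∈S , uv , v∉S) =
            let C , S′⊆C , closed , reachC = saturate (S ∪ ⁅ v ⁆)
                  (rec (p⊆p∪q ⁅ v ⁆ , v , x∈p∪q⁺ (inj₂ (x∈⁅x⁆ v)) , v∉S)) reach′
            in C , S′⊆C ∘ p⊆p∪q ⁅ v ⁆ , closed , reachC
        where
        reach′ : ∀ {w} → w ∈ S ∪ ⁅ v ⁆ → Star (Adj G) _ w
        reach′ w∈ with x∈p∪q⁻ S ⁅ v ⁆ w∈
        ... | inj₁ w∈S = reach w∈S
        ... | inj₂ w∈v with refl ← x∈⁅y⁆⇒x≡y v w∈v = reach u∈S ◅◅ (uv ◅ ε)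

    component-of : ∀ i → ∃ λ C → IsComponent G C × i ∈ C × (∀ {v} → v ∈ C → Star (Adj G) i v)
    component-of i =
      let C , i⊆C , closed , reach = saturate ⁅ i ⁆ (⊃-wellFounded ⁅ i ⁆)
            (λ v∈i → subst (Star (Adj G) i) (sym (x∈⁅y⁆⇒x≡y i v∈i)) ε)
          i∈C = i⊆C (x∈⁅x⁆ i)
      in C
       , ( (i , i∈C)
         , λ u v u∈C → mk⇔ (λ v∈C → reverse (symm G) (reach u∈C) ◅◅ reach v∈C)
                           (closed-star closed u∈C))
       , i∈C
       , reach

    -- The two neighbourhoods are disjoint; the strict inequality comes from `v` itself, which lies
    -- in neither.
    ∣neighbours∣-complement : ∀ v → ∣ neighbours G v ∣ < n ∸ ∣ neighbours (complement G) v ∣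
    ∣neighbours∣-complement v = subst (∣ neighbours G v ∣ <_) (∣∁p∣≡n∸∣p∣ (neighbours (complement G) v))
      (p⊂q⇒∣p∣<∣q∣ ((λ u∈N → x∉p⇒x∈∁p λ u∈N̄ → proj₂ (co⁻ u∈N̄) (∈-neighbours⁻ u∈N))
                   , v , x∉p⇒x∈∁p (λ v∈N̄ → proj₁ (co⁻ v∈N̄) refl)
                   , λ v∈N → irrefl G refl (∈-neighbours⁻ v∈N)))
      where
      co⁻ : ∀ {u} → u ∈ neighbours (complement G) v → v ≢ u × ¬ Adj G v u
      co⁻ {u} u∈ = does⇒ (adj? (complement G) v u) (trans (sym (lookup∘tabulate _ u)) ([]=⇒lookup u∈))

  -- Separators and the degree bound.

  κ≥⇒≤∣separator∣ : ∀ (H : Graph n) {S} → κ[ H ]≥ k → Disconnects H S → k ≤ ∣ S ∣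
  κ≥⇒≤∣separator∣ H (_ , (_ , min) , k≤m) disc = ≤-trans k≤m (min _ (inj₁ disc))

  -- The size bound leaves a vertex `w` other than `v` outside the neighbourhood, and deleting the
  -- neighbourhood isolates `v`.
  neighbours-disconnect : ∀ (H : Graph n) v → suc ∣ neighbours H v ∣ < n → Disconnects H (neighbours H v)
  neighbours-disconnect {n} H v small
    with any? (λ w → ¬? (w ∈? neighbours H v) ×-dec ¬? (w ≟ᶠ v))
  ... | yes (w , w∉N , w≢v) = v , w , (λ v∈N → irrefl H refl (∈-neighbours⁻ H v∈N)) , w∉N , isolated
    where
    isolated : ¬ Star (AdjDel H (neighbours H v)) v w
    isolated ε                        = w≢v refl
    isolated ((_ , u∉N , vu) ◅ _) = u∉N (∈-neighbours⁺ H vu)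
  -- Otherwise at most `v` lies outside its neighbourhood, so `n` is at most one more than the
  -- degree.
  ... | no none = contradiction small (<⇒≱ (s≤s (subst (n ≤_) (+-comm N 1)
      (≤-trans (m≤n+m∸n n N) (+-monoʳ-≤ N ≤1)))))
    where
    N = ∣ neighbours H v ∣
    ≤1 : n ∸ N ≤ 1
    ≤1 = subst (_≤ 1) (∣∁p∣≡n∸∣p∣ (neighbours H v)) (≤-trans
      (p⊆q⇒∣p∣≤∣q∣ λ {w} w∈ → subst (_∈ ⁅ v ⁆)
        (sym (decidable-stable (w ≟ᶠ v) λ w≢v → none (w , x∈∁p⇒x∉p w∈ , w≢v))) (x∈⁅x⁆ v))
      (≤-reflexive (∣⁅x⁆∣≡1 v)))

  -- The assumption `2 ≤ k` enters the counting here: a vertex together with up to `k` neighbours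
  -- misses one of the `2 * k` vertices.
  1+k<2*k : 2 ≤ k → suc k < 2 * k
  1+k<2*k {k} 2≤k = subst (λ j → suc k < k + j) (sym (+-identityʳ k))
    (subst (_≤ k + k) (+-comm k 2) (+-monoʳ-≤ k 2≤k))

  2*k∸k≡k : ∀ k → 2 * k ∸ k ≡ k
  2*k∸k≡k k = trans (m+n∸m≡n k (k + 0)) (+-identityʳ k)

  admissible⇒degree< : 2 ≤ k → (G : Graph (2 * k)) → Admissible k G → ∀ v → ∣ neighbours G v ∣ < k
  admissible⇒degree< {k} 2≤k G (_ , κ≥k) v = <-≤-trans (∣neighbours∣-complement G v)
    (≤-trans (∸-monoʳ-≤ (2 * k) k≤codegree) (≤-reflexive (2*k∸k≡k k)))
    where
    k≤codegree : k ≤ ∣ neighbours (complement G) v ∣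
    k≤codegree with ≤-<-connex k ∣ neighbours (complement G) v ∣
    ... | inj₁ k≤ = k≤
    -- A codegree below `k` turns the neighbourhood into a separator, and connectivity forces every
    -- separator to have at least `k` vertices.
    ... | inj₂ <k = κ≥⇒≤∣separator∣ (complement G) κ≥k
      (neighbours-disconnect (complement G) v (<-≤-trans (s≤s <k) (<⇒≤ (1+k<2*k 2≤k))))

  -- The graph `B k` and the connectivity of its complement.

  part-combine : ∀ a (i : Fin k) → part k (combine a i) ≡ a
  part-combine a i = cong proj₁ (remQuot-combine a i)

  index-combine : ∀ (a : Fin 2) (i : Fin k) → index k (combine a i) ≡ i
  index-combine a i = cong proj₂ (remQuot-combine a i)

  B-triangleFree : ∀ k → TriangleFree (B k)
  B-triangleFree k u v w ((u≢v , _) , (v≢w , _) , (u≢w , _)) = pigeonhole _ _ _ u≢v v≢w u≢w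
    where
    pigeonhole : (a b c : Fin 2) → a ≢ b → b ≢ c → ¬ a ≢ c
    pigeonhole zero       zero       _          a≢b _   _   = a≢b refl
    pigeonhole zero       (suc zero) zero       _   _   a≢c = a≢c refl
    pigeonhole zero       (suc zero) (suc zero) _   b≢c _   = b≢c refl
    pigeonhole (suc zero) zero       zero       _   b≢c _   = b≢c refl
    pigeonhole (suc zero) zero       (suc zero) _   _   a≢c = a≢c refl
    pigeonhole (suc zero) (suc zero) _          a≢b _   _   = a≢b refl

  -- The neighbours exhibited lie in the opposite part; `punchIn` runs through all indices except
  -- that of `v`, which avoids the deleted matching edge.
  B-degree≥ : ∀ k v → k ∸ 1 ≤ ∣ neighbours (B k) v ∣
  B-degree≥ zero    v = z≤n
  B-degree≥ (suc d) v = injection⇒≤∣∣ (neighbours (B (suc d)) v) across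
    (λ {i} {j} eq → punchIn-injective (index _ v) i j (combine-injectiveʳ a _ a _ eq))
    λ j → ∈-neighbours⁺ (B (suc d)) {v}
      ( (λ eq → a≢opposite _ (trans eq (part-combine a (punchIn (index (suc d) v) j))))
      , λ (_ , eq) → punchInᵢ≢i (index _ v) j (sym (trans eq (index-combine a (punchIn (index (suc d) v) j)))))
    where
    a = opposite (part (suc d) v)
    across : Fin d → Fin (2 * suc d)
    across j = combine a (punchIn (index (suc d) v) j)
    a≢opposite : (b : Fin 2) → b ≢ opposite b
    a≢opposite zero       ()
    a≢opposite (suc zero) ()

  module _ {S : Subset (2 * k)} where
    private
      H = complement (B k)

    -- The complement of `B k` is the 2 by k rook's graph, two cliques joined by a perfect matching.
    -- Vertices sharing a part or an index are therefore equal or adjacent in it.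
    line : ∀ {u v} → u ∉ S → v ∉ S → part k u ≡ part k v ⊎ index k u ≡ index k v →
           Star (AdjDel H S) u v
    line {u} {v} u∉S v∉S collinear with u ≟ᶠ v
    ... | yes refl = ε
    ... | no  u≢v  = (u∉S , v∉S , u≢v , λ (p≢ , ¬M) → lemma p≢ ¬M collinear) ◅ ε
      where
      lemma : part k u ≢ part k v → ¬ (part k u ≢ part k v × index k u ≡ index k v) →
              ¬ (part k u ≡ part k v ⊎ index k u ≡ index k v)
      lemma p≢ ¬M (inj₁ p≡) = p≢ p≡
      lemma p≢ ¬M (inj₂ i≡) = ¬M (p≢ , i≡)

    -- Fewer than k deletions leave some matching edge of the complement
    -- intact; it joins the two cliques.
    disconnects⇒k≤ : Disconnects H S → k ≤ ∣ S ∣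
    disconnects⇒k≤ (u , v , u∉S , v∉S , ¬uv) with all? (λ i → any? (λ a → combine {2} {k} a i ∈? S))
    ... | yes hit = injection⇒≤∣∣ S (λ i → combine (proj₁ (hit i)) i)
                      (λ {i} {j} → combine-injectiveʳ (proj₁ (hit i)) i (proj₁ (hit j)) j) (proj₂ ∘ hit)
    ... | no ¬hit =
      let i , free = ¬∀⟶∃¬ k _ (λ i → any? λ a → combine {2} {k} a i ∈? S) ¬hit
          i∉S = λ a a∈ → free (a , a∈)
          pu = part k u
          pv = part k v
      in contradiction
           ( line u∉S (i∉S pu) (inj₁ (sym (part-combine pu i)))
          ◅◅ line (i∉S pu) (i∉S pv) (inj₂ (trans (index-combine pu i) (sym (index-combine pv i))))
          ◅◅ line (i∉S pv) v∉S (inj₁ (part-combine pv i)))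
           ¬uv

  -- The complement has connectivity exactly `k`, attained by the neighbourhood `N` of one vertex.
  -- That vertex has at least `k - 1` neighbours in `B k`, so `N` has at most `k` elements; being a
  -- separator, it has at least `k`.
  B-admissible : 2 ≤ k → Admissible k (B k)
  B-admissible {k@(suc d)} 2≤k =
    B-triangleFree k , k , ((N , inj₁ N-disconnects , ∣N∣≡k) , minimal) , ≤-reflexive refl
    where
    H = complement (B k)
    v : Fin (2 * k)
    v = zero
    N = neighbours H v

    ∣N∣≤k : ∣ N ∣ ≤ k
    ∣N∣≤k = ≤-trans (bound (≤-<-trans (B-degree≥ k v) (∣neighbours∣-complement (B k) v)) (∣p∣≤n N))
                    (≤-reflexive (2*k∸k≡k k))
      where
      bound : ∀ {a b c} → a < c ∸ b → b ≤ c → b ≤ c ∸ suc a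
      bound {a} {b} {c} a<c∸b b≤c =
        m+n≤o⇒m≤o∸n b (subst (_≤ c) (+-comm (suc a) b) (m≤o∸n⇒m+n≤o (suc a) b≤c a<c∸b))

    N-disconnects : Disconnects H N
    N-disconnects = neighbours-disconnect H v (≤-<-trans (s≤s ∣N∣≤k) (1+k<2*k 2≤k))

    ∣N∣≡k : ∣ N ∣ ≡ k
    ∣N∣≡k = ≤-antisym ∣N∣≤k (disconnects⇒k≤ N-disconnects)

    minimal : ∀ S → Disconnects H S ⊎ LeavesSingleVertex S → k ≤ ∣ S ∣
    minimal S (inj₁ disc)   = disconnects⇒k≤ disc
    -- Such a set has `2 * k - 1` elements.
    minimal S (inj₂ single) =
      s≤s⁻¹ (≤-trans (<⇒≤ (1+k<2*k 2≤k)) (subst (2 * k ≤_) eq (m≤n+m∸n (2 * k) ∣ S ∣)))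
      where
      eq : ∣ S ∣ + (2 * k ∸ ∣ S ∣) ≡ suc ∣ S ∣
      eq = trans (cong (∣ S ∣ +_) (trans (sym (∣∁p∣≡n∸∣p∣ S)) single)) (+-comm ∣ S ∣ 1)

-- Order and sign arithmetic over the reals.

module OrderedField {c ℓ₁ ℓ₂} (ℝ : RealNumbers c ℓ₁ ℓ₂) where
  import Algebra.Apartness.Properties.HeytingCommutativeRing as HeytingProperties
  open import Algebra.Bundles using (CommutativeRing)
  import Algebra.Properties.Monoid.Mult as MonoidMult
  import Algebra.Properties.Ring as RingProperties
  import Algebra.Properties.Semiring.Sum as SemiringSum
  import Algebra.Solver.Ring.NaturalCoefficients.Default as NaturalSolver
  open import Data.Bool.Base using (true; false; _∧_; if_then_else_)
  open import Data.Nat.Base using () renaming (_+_ to _+ℕ_)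
  open import Data.Nat.Properties using (≤-antisym; m∸n≡0⇒m≤n; m+[n∸m]≡n)
  open import Data.Sum.Base using ([_,_]′)
  open import Data.Vec.Base using (lookup; []; _∷_)
  open import Data.Vec.Functional using (Vector)
  open import Data.Vec.Properties using (lookup-zipWith)
  open import Relation.Binary.PropositionalEquality as ≡ using (_≡_)
  open import Relation.Binary.Structures using (module IsStrictPartialOrder)
  open import Relation.Nullary.Decidable using (does-⇔)

  open GraphTheory using (Closed; component-of; component-closed; closed⇒∩-neighbours)
  open RealNumbers ℝ hiding (zero) renaming (_<_ to _<ᴿ_; _≤_ to _≤ᴿ_)
  open IsStrictPartialOrder isStrictPartialOrder
    using (<-respʳ-≈; <-respˡ-≈) renaming (irrefl to <-irrefl; trans to <-trans)
  open HeytingProperties heytingCommutativeRing using (1#0; #-congʳ)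
  open CommutativeRing commutativeRing using (ring; semiring; commutativeSemiring)
  open RingProperties ring
    using (-‿involutive; -‿distribˡ-*; -‿distribʳ-*; +-cancelʳ; x∙y⁻¹≈ε⇒x≈y)
  open SemiringSum semiring
    using (∑-distrib-+; ∑-comm; *-distribˡ-sum; *-distribʳ-sum)
    renaming (sum-cong-≋ to sum-cong)
  open NaturalSolver commutativeSemiring using (solve; _:=_; _:+_; _:*_)
  open import Relation.Binary.Reasoning.Setoid setoid

  private
    variable
      n : ℕ
      x y : Carrier

  -- Tightness is the source of equations below: apartness is assumed and refuted.
  ≈-or-# : ¬ x # y → x ≈ y
  ≈-or-# = proj₁ (tight _ _)

  <0⇒0<- : x <ᴿ 0# → 0# <ᴿ - x
  <0⇒0<- {x} x<0 = <-respˡ-≈ (-‿inverseʳ x) (<-respʳ-≈ (+-identityˡ (- x)) (+-monoˡ-< (- x) x<0))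

  <⇒0<- : x <ᴿ y → 0# <ᴿ y - x
  <⇒0<- {x} x<y = <-respˡ-≈ (-‿inverseʳ x) (+-monoˡ-< (- x) x<y)

  #0⇒0<² : x # 0# → 0# <ᴿ x * x
  #0⇒0<² {x} x#0 with Equivalence.to (#⇔<⊎> x 0#) x#0
  ... | inj₁ x<0 = <-respʳ-≈ (trans (sym (-‿distribˡ-* x (- x)))
                     (trans (-‿cong (sym (-‿distribʳ-* x x))) (-‿involutive (x * x))))
                   (*-pos (<0⇒0<- x<0) (<0⇒0<- x<0))
  ... | inj₂ 0<x = *-pos 0<x 0<x

  0<⇒≉0 : 0# <ᴿ x → ¬ x ≈ 0#
  0<⇒≉0 0<x x≈0 = <-irrefl (sym x≈0) 0<x

  -- `1#` is apart from zero and is its own square.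
  0<1 : 0# <ᴿ 1#
  0<1 = <-respʳ-≈ (*-identityˡ 1#) (#0⇒0<² 1#0)

  0<+ : 0# <ᴿ x → 0# <ᴿ y → 0# <ᴿ x + y
  0<+ {x} {y} 0<x 0<y = <-trans 0<y (<-respˡ-≈ (+-identityˡ y) (+-monoˡ-< y 0<x))

  0<fromℕ-suc : ∀ m → 0# <ᴿ fromℕ (suc m)
  0<fromℕ-suc zero    = <-respʳ-≈ (sym (+-identityʳ 1#)) 0<1
  0<fromℕ-suc (suc m) = 0<+ 0<1 (0<fromℕ-suc m)

  <⇒≤ᴿ : x <ᴿ y → x ≤ᴿ y
  <⇒≤ᴿ x<y y<x = <-irrefl refl (<-trans x<y y<x)

  ≤ᴿ-reflexive : x ≈ y → x ≤ᴿ y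
  ≤ᴿ-reflexive x≈y = <-irrefl (sym x≈y)

  0≤fromℕ : ∀ m → 0# ≤ᴿ fromℕ m
  0≤fromℕ zero    = <-irrefl refl
  0≤fromℕ (suc m) = <⇒≤ᴿ (0<fromℕ-suc m)

  0≤² : ∀ x → 0# ≤ᴿ x * x
  0≤² x xx<0 = <-irrefl (trans (*-congʳ x≈0) (zeroˡ x)) xx<0
    where
    x≈0 : x ≈ 0#
    x≈0 = ≈-or-# λ x#0 → <-irrefl refl (<-trans xx<0 (#0⇒0<² x#0))

  0≤∧0≮⇒≈0 : 0# ≤ᴿ x → ¬ 0# <ᴿ x → x ≈ 0#
  0≤∧0≮⇒≈0 0≤x 0≮x = ≈-or-# λ x#0 → [ 0≤x , 0≮x ]′ (Equivalence.to (#⇔<⊎> _ _) x#0)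

  -- Signs are not decidable: a failing strict inequality is turned into an
  -- equation by the tightness of apartness.
  0≤+ : 0# ≤ᴿ x → 0# ≤ᴿ y → 0# ≤ᴿ x + y
  0≤+ {x} {y} 0≤x 0≤y x+y<0 = 0≤y (<-respˡ-≈ (trans (+-congʳ x≈0) (+-identityˡ y)) x+y<0)
    where
    x≈0 : x ≈ 0#
    x≈0 = 0≤∧0≮⇒≈0 0≤x λ 0<x →
      0≤y (<-trans (<-respˡ-≈ (+-identityˡ y) (+-monoˡ-< y 0<x)) x+y<0)

  -- Suppose the product is negative. If `x` were positive, `y` could not be, so `y` and the product
  -- would be zero. Hence `x` is zero, and the product is zero again.
  0≤* : 0# ≤ᴿ x → 0# ≤ᴿ y → 0# ≤ᴿ x * y
  0≤* {x} {y} 0≤x 0≤y xy<0 = <-irrefl (trans (*-congʳ x≈0) (zeroˡ y)) xy<0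
    where
    x≈0 : x ≈ 0#
    x≈0 = 0≤∧0≮⇒≈0 0≤x λ 0<x → <-irrefl (trans (*-congˡ (0≤∧0≮⇒≈0 0≤y λ 0<y →
      <-irrefl refl (<-trans xy<0 (*-pos 0<x 0<y)))) (zeroʳ x)) xy<0

  +≈0⇒≈0ˡ : 0# ≤ᴿ x → 0# ≤ᴿ y → x + y ≈ 0# → x ≈ 0#
  +≈0⇒≈0ˡ {x} {y} 0≤x 0≤y x+y≈0 = 0≤∧0≮⇒≈0 0≤x λ 0<x →
    0≤y (<-respˡ-≈ (+-identityˡ y) (<-respʳ-≈ x+y≈0 (+-monoˡ-< y 0<x)))

  +≈0⇒≈0ʳ : 0# ≤ᴿ x → 0# ≤ᴿ y → x + y ≈ 0# → y ≈ 0#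
  +≈0⇒≈0ʳ 0≤x 0≤y x+y≈0 = +≈0⇒≈0ˡ 0≤y 0≤x (trans (+-comm _ _) x+y≈0)

  *≈0⇒≈0 : 0# <ᴿ y → 0# ≤ᴿ x → x * y ≈ 0# → x ≈ 0#
  *≈0⇒≈0 0<y 0≤x xy≈0 = 0≤∧0≮⇒≈0 0≤x λ 0<x → 0<⇒≉0 (*-pos 0<x 0<y) xy≈0

  ²≈0⇒≈0 : x * x ≈ 0# → x ≈ 0#
  ²≈0⇒≈0 xx≈0 = ≈-or-# λ x#0 → 0<⇒≉0 (#0⇒0<² x#0) xx≈0

  fromℕ≈0⇒≡0 : ∀ m → fromℕ m ≈ 0# → m ≡ 0
  fromℕ≈0⇒≡0 zero    _  = ≡.refl
  fromℕ≈0⇒≡0 (suc m) eq = contradiction eq (0<⇒≉0 (0<fromℕ-suc m))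

  fromℕ-+ : ∀ a b → fromℕ (a +ℕ b) ≈ fromℕ a + fromℕ b
  fromℕ-+ = MonoidMult.×-homo-+ (CommutativeRing.+-monoid commutativeRing) 1#

  -- Finite sums and indicator vectors.

  0≤sum : (t : Vector Carrier n) → (∀ i → 0# ≤ᴿ t i) → 0# ≤ᴿ sum t
  0≤sum {zero}  t 0≤t = <-irrefl refl
  0≤sum {suc n} t 0≤t = 0≤+ (0≤t zero) (0≤sum (t ∘ suc) (0≤t ∘ suc))

  sum≈0⇒≈0 : (t : Vector Carrier n) → (∀ i → 0# ≤ᴿ t i) → sum t ≈ 0# → ∀ i → t i ≈ 0#
  sum≈0⇒≈0 t 0≤t eq zero    = +≈0⇒≈0ˡ (0≤t zero) (0≤sum (t ∘ suc) (0≤t ∘ suc)) eq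
  sum≈0⇒≈0 t 0≤t eq (suc i) =
    sum≈0⇒≈0 (t ∘ suc) (0≤t ∘ suc) (+≈0⇒≈0ʳ (0≤t zero) (0≤sum (t ∘ suc) (0≤t ∘ suc)) eq) i

  sum-zero : (t : Vector Carrier n) → (∀ i → t i ≈ 0#) → sum t ≈ 0#
  sum-zero {zero}  t t≈0 = refl
  sum-zero {suc n} t t≈0 = trans (+-cong (t≈0 zero) (sum-zero (t ∘ suc) (t≈0 ∘ suc))) (+-identityˡ 0#)

  indicator : Subset n → Vector Carrier n
  indicator S i = if lookup S i then 1# else 0#

  sum-indicator : (S : Subset n) → sum (indicator S) ≈ fromℕ ∣ S ∣
  sum-indicator []          = refl
  sum-indicator (true  ∷ S) = +-congˡ (sum-indicator S)
  sum-indicator (false ∷ S) = trans (+-identityˡ _) (sum-indicator S)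

  indicator-∈ : ∀ {S : Subset n} {i} → i ∈ S → indicator S i ≡ 1#
  indicator-∈ i∈S = ≡.cong (if_then 1# else 0#) ([]=⇒lookup i∈S)

  indicator-∉ : ∀ {S : Subset n} {i} → i ∉ S → indicator S i ≡ 0#
  indicator-∉ {S = S} {i} i∉S with lookup S i in eq
  ... | true  = contradiction (lookup⇒[]= i S eq) i∉S
  ... | false = ≡.refl

  indicator-∩ : ∀ (S T : Subset n) i → indicator S i * indicator T i ≈ indicator (S ∩ T) i
  indicator-∩ S T i rewrite lookup-zipWith _∧_ i S T with lookup S i | lookup T i
  ... | true  | true  = *-identityˡ 1#
  ... | true  | false = *-identityˡ 0#
  ... | false | _     = zeroˡ _

  0≤indicator : ∀ (S : Subset n) i → 0# ≤ᴿ indicator S i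
  0≤indicator S i with lookup S i
  ... | true  = <⇒≤ᴿ 0<1
  ... | false = <-irrefl refl

  -- Adjacency matrices and eigenvectors.

  open Spectral ℝ

  module AdjacencySpectrum (G : Graph n) where

    A : Matrix n
    A = adjacencyMatrix G

    deg : Fin n → ℕ
    deg i = ∣ neighbours G i ∣

    A≡indicator : ∀ i j → A i j ≡ indicator (neighbours G i) j
    A≡indicator i j = ≡.cong (if_then 1# else 0#) (≡.sym (lookup∘tabulate _ j))

    A-adj : ∀ {i j} → Adj G i j → A i j ≡ 1#
    A-adj {i} {j} ij = ≡.cong (if_then 1# else 0#) (dec-true (adj? G i j) ij)

    A-symmetric : ∀ i j → A i j ≡ A j i
    A-symmetric i j = ≡.cong (if_then 1# else 0#)
      (does-⇔ (mk⇔ (symm G) (symm G)) (adj? G i j) (adj? G j i))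

    0≤A : ∀ i j → 0# ≤ᴿ A i j
    0≤A i j rewrite A≡indicator i j = 0≤indicator (neighbours G i) j

    row-sum : ∀ i → sum (A i) ≈ fromℕ (deg i)
    row-sum i = trans (sum-cong (reflexive ∘ A≡indicator i)) (sum-indicator (neighbours G i))

    -- The eigenvector is the indicator of `C`: a row inside `C` counts `d` neighbours in `C`, and a
    -- row outside meets no vertex of `C`, since no edge leaves a closed set.
    regular⇒eigenvalue : ∀ {C d} → Nonempty C → Closed G C →
                         (∀ v → v ∈ C → ∣ C ∩ neighbours G v ∣ ≡ d) → IsEigenvalue A (fromℕ d)
    regular⇒eigenvalue {C} {d} (u , u∈C) closed regular =
      indicator C , (u , #-congʳ (sym (reflexive (indicator-∈ u∈C))) 1#0) , eigen
      where
      eigen : ∀ i → (A · indicator C) i ≈ fromℕ d * indicator C i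
      eigen i with i ∈? C
      ... | yes i∈C = begin
        sum (λ j → A i j * indicator C j)
          ≈⟨ sum-cong (λ j → *-comm (A i j) (indicator C j)) ⟩
        sum (λ j → indicator C j * A i j)
          ≈⟨ sum-cong (λ j → *-congˡ (reflexive (A≡indicator i j))) ⟩
        sum (λ j → indicator C j * indicator (neighbours G i) j)
          ≈⟨ sum-cong (indicator-∩ C (neighbours G i)) ⟩
        sum (indicator (C ∩ neighbours G i))  ≈⟨ sum-indicator (C ∩ neighbours G i) ⟩
        fromℕ ∣ C ∩ neighbours G i ∣          ≡⟨ ≡.cong fromℕ (regular i i∈C) ⟩
        fromℕ d                               ≈⟨ *-identityʳ _ ⟨
        fromℕ d * 1#                          ≡⟨ ≡.cong (fromℕ d *_) (indicator-∈ i∈C) ⟨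
        fromℕ d * indicator C i               ∎
      ... | no i∉C = begin
        sum (λ j → A i j * indicator C j) ≈⟨ sum-zero _ vanish ⟩
        0#                                ≈⟨ zeroʳ (fromℕ d) ⟨
        fromℕ d * 0#                      ≡⟨ ≡.cong (fromℕ d *_) (indicator-∉ i∉C) ⟨
        fromℕ d * indicator C i           ∎
        where
        vanish : ∀ j → A i j * indicator C j ≈ 0#
        vanish j with j ∈? C | adj? G i j
        ... | no j∉C | _ = trans (*-congˡ (reflexive (indicator-∉ j∉C))) (zeroʳ _)
        ... | yes j∈C | yes ij = contradiction (closed j∈C (symm G ij)) i∉C
        ... | yes j∈C | no _   = zeroˡ _

    -- The vanishing sum of nonnegative terms.

    module _ {d : ℕ} (deg≤d : ∀ i → deg i ≤ d)
             {s : Carrier} (d≤s : 0# ≤ᴿ s - fromℕ d)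
             (x : Vector Carrier n) (Ax≈sx : ∀ i → (A · x) i ≈ s * x i) where

      private
        e : Carrier
        e = s - fromℕ d

        -- `defect i` is the summand of the identity at vertex `i`. The slack appears twice because
        -- summing `gap` over all vertices meets each edge from both ends.
        slack gap row defect : Fin n → Carrier
        slack i = e * (x i * x i) + fromℕ (d ∸ deg i) * (x i * x i)
        gap i = sum λ j → A i j * ((x i - x j) * (x i - x j))
        row i = sum λ j → A i j * (x j * x j)
        defect i = (slack i + slack i) + gap i

        -- Expansion of the square. Writing `u` as `w + v` removes the subtraction, so that a solver
        -- for commutative semirings applies.
        edge-gap : ∀ a u v → a * ((u - v) * (u - v)) + (u + u) * (a * v) ≈ a * (u * u) + a * (v * v)
        edge-gap a u v = begin
          a * (w * w) + (u + u) * (a * v)             ≈⟨ +-congˡ (*-congʳ (+-cong u≈w+v u≈w+v)) ⟩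
          a * (w * w) + (w + v + (w + v)) * (a * v)   ≈⟨ solve 3 (λ a w v →
              a :* (w :* w) :+ (w :+ v :+ (w :+ v)) :* (a :* v)
              := a :* ((w :+ v) :* (w :+ v)) :+ a :* (v :* v)) refl a w v ⟩
          a * ((w + v) * (w + v)) + a * (v * v)       ≈⟨ +-congʳ (*-congˡ (*-cong u≈w+v u≈w+v)) ⟨
          a * (u * u) + a * (v * v)                   ∎
          where
          w = u - v
          u≈w+v : u ≈ w + v
          u≈w+v = sym (trans (+-assoc u (- v) v) (trans (+-congˡ (-‿inverseˡ v)) (+-identityʳ u)))

        -- `edge-gap` is summed over `j`; the eigenvector equation evaluates the cross terms, and
        -- the row sum gives the degree.
        gap-row : ∀ i → gap i + (x i + x i) * (s * x i) ≈ fromℕ (deg i) * (x i * x i) + row i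
        gap-row i = begin
          gap i + (x i + x i) * (s * x i)
            ≈⟨ +-congˡ (*-congˡ (Ax≈sx i)) ⟨
          gap i + (x i + x i) * sum (λ j → A i j * x j)
            ≈⟨ +-congˡ (*-distribˡ-sum (x i + x i) (λ j → A i j * x j)) ⟩
          gap i + sum (λ j → (x i + x i) * (A i j * x j))
            ≈⟨ ∑-distrib-+ (λ j → A i j * ((x i - x j) * (x i - x j))) (λ j → (x i + x i) * (A i j * x j)) ⟨
          sum (λ j → A i j * ((x i - x j) * (x i - x j)) + (x i + x i) * (A i j * x j))
            ≈⟨ sum-cong (λ j → edge-gap (A i j) (x i) (x j)) ⟩
          sum (λ j → A i j * (x i * x i) + A i j * (x j * x j))
            ≈⟨ ∑-distrib-+ (λ j → A i j * (x i * x i)) (λ j → A i j * (x j * x j)) ⟩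
          sum (λ j → A i j * (x i * x i)) + row i
            ≈⟨ +-congʳ (*-distribʳ-sum (x i * x i) (A i)) ⟨
          sum (A i) * (x i * x i) + row i
            ≈⟨ +-congʳ (*-congʳ (row-sum i)) ⟩
          fromℕ (deg i) * (x i * x i) + row i ∎

        s-split : ∀ i → s ≈ e + (fromℕ (deg i) + fromℕ (d ∸ deg i))
        s-split i = begin
          s                                             ≈⟨ +-identityʳ s ⟨
          s + 0#                                        ≈⟨ +-congˡ (-‿inverseˡ (fromℕ d)) ⟨
          s + (- fromℕ d + fromℕ d)                     ≈⟨ +-assoc _ _ _ ⟨
          e + fromℕ d                                   ≡⟨ ≡.cong (λ m → e + fromℕ m) (m+[n∸m]≡n (deg≤d i)) ⟨
          e + fromℕ (deg i +ℕ (d ∸ deg i)) ≈⟨ +-congˡ (fromℕ-+ (deg i) (d ∸ deg i)) ⟩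
          e + (fromℕ (deg i) + fromℕ (d ∸ deg i))       ∎

        -- This says that the defect is `row i` minus `q`, in a form free of subtraction. A second
        -- `q` is added to both sides so that `e`, the degree and its shortfall from `d` recombine
        -- to `s` in the doubled term.
        defect-row : ∀ i → defect i + fromℕ (deg i) * (x i * x i) ≈ row i
        defect-row i = +-cancelʳ q _ _ (begin
          (slack i + slack i + gap i) + q + q
            ≈⟨ solve 5 (λ e f g y p →
                 ((e :* (y :* y) :+ f :* (y :* y)) :+ (e :* (y :* y) :+ f :* (y :* y)) :+ p)
                   :+ g :* (y :* y) :+ g :* (y :* y)
                 := p :+ (y :+ y) :* ((e :+ (g :+ f)) :* y)) refl
               e (fromℕ (d ∸ deg i)) (fromℕ (deg i)) (x i) (gap i) ⟩
          gap i + (x i + x i) * ((e + (fromℕ (deg i) + fromℕ (d ∸ deg i))) * x i)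
            ≈⟨ +-congˡ (*-congˡ (*-congʳ (s-split i))) ⟨
          gap i + (x i + x i) * (s * x i)
            ≈⟨ gap-row i ⟩
          q + row i
            ≈⟨ +-comm _ _ ⟩
          row i + q ∎)
          where q = fromℕ (deg i) * (x i * x i)

        column-sum : ∀ j → sum (λ i → A i j) ≈ fromℕ (deg j)
        column-sum j = trans (sum-cong (λ i → reflexive (A-symmetric i j))) (row-sum j)

        -- Double counting: after exchanging the sums, symmetry makes each column sum a degree.
        sum-row : sum row ≈ sum (λ i → fromℕ (deg i) * (x i * x i))
        sum-row = begin
          sum (λ i → sum λ j → A i j * (x j * x j)) ≈⟨ ∑-comm (λ i j → A i j * (x j * x j)) ⟩
          sum (λ j → sum λ i → A i j * (x j * x j))
            ≈⟨ sum-cong (λ j → *-distribʳ-sum (x j * x j) (λ i → A i j)) ⟨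
          sum (λ j → sum (λ i → A i j) * (x j * x j)) ≈⟨ sum-cong (λ j → *-congʳ (column-sum j)) ⟩
          sum (λ j → fromℕ (deg j) * (x j * x j)) ∎

        sum-defect : sum defect ≈ 0#
        sum-defect = +-cancelʳ (sum row) _ _ (begin
          sum defect + sum row                                          ≈⟨ +-congˡ sum-row ⟩
          sum defect + sum (λ i → fromℕ (deg i) * (x i * x i))          ≈⟨ ∑-distrib-+ defect (λ i → fromℕ (deg i) * (x i * x i)) ⟨
          sum (λ i → defect i + fromℕ (deg i) * (x i * x i))            ≈⟨ sum-cong defect-row ⟩
          sum row                                                       ≈⟨ +-identityˡ _ ⟨
          0# + sum row                                                  ∎)

        0≤slackˡ : ∀ i → 0# ≤ᴿ e * (x i * x i)
        0≤slackˡ i = 0≤* d≤s (0≤² (x i))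

        0≤slackʳ : ∀ i → 0# ≤ᴿ fromℕ (d ∸ deg i) * (x i * x i)
        0≤slackʳ i = 0≤* (0≤fromℕ (d ∸ deg i)) (0≤² (x i))

        0≤slack : ∀ i → 0# ≤ᴿ slack i
        0≤slack i = 0≤+ (0≤slackˡ i) (0≤slackʳ i)

        0≤edge : ∀ i j → 0# ≤ᴿ A i j * ((x i - x j) * (x i - x j))
        0≤edge i j = 0≤* (0≤A i j) (0≤² (x i - x j))

        0≤gap : ∀ i → 0# ≤ᴿ gap i
        0≤gap i = 0≤sum _ (0≤edge i)

        defect≈0 : ∀ i → defect i ≈ 0#
        defect≈0 = sum≈0⇒≈0 defect (λ i → 0≤+ (0≤+ (0≤slack i) (0≤slack i)) (0≤gap i)) sum-defect

        slack≈0 : ∀ i → slack i ≈ 0#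
        slack≈0 i = +≈0⇒≈0ˡ (0≤slack i) (0≤slack i)
          (+≈0⇒≈0ˡ (0≤+ (0≤slack i) (0≤slack i)) (0≤gap i) (defect≈0 i))

      support⇒s≈d : ∀ {i} → x i # 0# → s - fromℕ d ≈ 0#
      support⇒s≈d {i} xi#0 = *≈0⇒≈0 (#0⇒0<² xi#0) d≤s
        (+≈0⇒≈0ˡ (0≤slackˡ i) (0≤slackʳ i) (slack≈0 i))

      support⇒deg≡d : ∀ {i} → x i # 0# → deg i ≡ d
      support⇒deg≡d {i} xi#0 = ≤-antisym (deg≤d i) (m∸n≡0⇒m≤n (fromℕ≈0⇒≡0 (d ∸ deg i)
        (*≈0⇒≈0 (#0⇒0<² xi#0) (0≤fromℕ (d ∸ deg i)) (+≈0⇒≈0ʳ (0≤slackˡ i) (0≤slackʳ i) (slack≈0 i)))))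

      adjacent⇒≈ : ∀ {i j} → Adj G i j → x i ≈ x j
      adjacent⇒≈ {i} {j} ij = x∙y⁻¹≈ε⇒x≈y (x i) (x j) (²≈0⇒≈0 (begin
        (x i - x j) * (x i - x j)         ≈⟨ *-identityˡ _ ⟨
        1# * ((x i - x j) * (x i - x j))  ≡⟨ ≡.cong (_* ((x i - x j) * (x i - x j))) (A-adj ij) ⟨
        A i j * ((x i - x j) * (x i - x j)) ≈⟨ sum≈0⇒≈0 _ (0≤edge i)
           (+≈0⇒≈0ʳ (0≤+ (0≤slack i) (0≤slack i)) (0≤gap i) (defect≈0 i)) j ⟩
        0# ∎))

      -- `x` takes equal values along edges, so its support is a union of components.
      support-connected : ∀ {i j} → Star (Adj G) i j → x i # 0# → x j # 0#
      support-connected ε         xi#0 = xi#0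
      support-connected (il ◅ lj) xi#0 = support-connected lj (#-congʳ (adjacent⇒≈ il) xi#0)

    -- The largest eigenvalue and regular components.

    module _ {d : ℕ} (deg≤d : ∀ i → deg i ≤ d) where

      -- An eigenvalue above `d` meets the hypothesis `0 ≤ s - d`, which forces `s - d` to vanish at
      -- a nonzero entry.
      eigenvalue≤ : ∀ s → IsEigenvalue A s → s ≤ᴿ fromℕ d
      eigenvalue≤ s (x , (i , xi#0) , Ax≈sx) d<s =
        0<⇒≉0 (<⇒0<- d<s) (support⇒s≈d deg≤d (<⇒≤ᴿ (<⇒0<- d<s)) x Ax≈sx xi#0)

      closed-regular⇒ρ : ∀ {C} → Nonempty C → Closed G C →
                         (∀ v → v ∈ C → ∣ C ∩ neighbours G v ∣ ≡ d) → ρ[ G ]≔ fromℕ d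
      closed-regular⇒ρ nonempty closed regular =
        regular⇒eigenvalue nonempty closed regular , eigenvalue≤

      ρ⇔regularComponent : (ρ[ G ]≔ fromℕ d) ⇔ HasRegularComponent G d
      ρ⇔regularComponent = mk⇔ to from
        where
        to : ρ[ G ]≔ fromℕ d → HasRegularComponent G d
        to ((x , (i , xi#0) , Ax≈dx) , _) =
          -- The case `s = d`: the required inequality `0 ≤ s - d` holds as an equality. The
          -- component is taken around a vertex where the eigenvector is nonzero.
          let d≤d = ≤ᴿ-reflexive (sym (-‿inverseʳ (fromℕ d)))
              C , comp , i∈C , reach = component-of G i
          in C , comp , λ v v∈C →
             ≡.trans (≡.cong ∣_∣ (closed⇒∩-neighbours G (component-closed G comp) v∈C))
                     (support⇒deg≡d deg≤d d≤d x Ax≈dx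
                       (support-connected deg≤d d≤d x Ax≈dx (reach v∈C) xi#0))

        from : HasRegularComponent G d → ρ[ G ]≔ fromℕ d
        from (C , comp@(nonempty , _) , regular) =
          closed-regular⇒ρ nonempty (component-closed G comp) regular

-- The extremal value, its equality case and the extremal graph.

open import Data.Nat.Base using (_*_; s≤s⁻¹)
open import Data.Nat.Properties using (≤-antisym)
open import Relation.Binary.PropositionalEquality using (_≡_; cong; trans)

open GraphTheory

proposition4p4 :
  ∀ {c ℓ₁ ℓ₂} (ℝ : RealNumbers c ℓ₁ ℓ₂) →
    let open RealNumbers ℝ using (fromℕ)
        open Spectral ℝ
    in
    (k : ℕ) → 2 ≤ k →
      (spexκ[ 2 * k ,K₃, k ]≔ fromℕ (k ∸ 1))
      × ((G : Graph (2 * k)) → Admissible k G →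
           (ρ[ G ]≔ fromℕ (k ∸ 1)) ⇔ HasRegularComponent G (k ∸ 1))
      × (Admissible k (B k) × (ρ[ B k ]≔ fromℕ (k ∸ 1)))
proposition4p4 ℝ k@(suc d) 2≤k =
  -- `B k` attains the maximum; the degree bound `d` for admissible graphs caps every other spectral
  -- radius.
  ((B k , B-admissible 2≤k , ρ-B) ,
    λ s (G , adm , (eigen , _)) → eigenvalue≤ G (degree≤ G adm) s eigen) ,
  (λ G adm → ρ⇔regularComponent G (degree≤ G adm)) ,
  B-admissible 2≤k , ρ-B
  where
  open RealNumbers ℝ using (fromℕ)
  open Spectral ℝ
  open OrderedField ℝ
  open AdjacencySpectrum

  degree≤ : ∀ G → Admissible k G → ∀ v → ∣ neighbours G v ∣ ≤ d
  degree≤ G adm v = s≤s⁻¹ (admissible⇒degree< 2≤k G adm v)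

  -- B 2 = 2K₂ is disconnected, so the closed set ⊤ replaces a component.
  ρ-B : ρ[ B k ]≔ fromℕ d
  ρ-B = closed-regular⇒ρ (B k) (degree≤ (B k) (B-admissible 2≤k)) (zero , ∈⊤) (λ _ _ → ∈⊤) ⊤-regular
    where
    ⊤-regular : ∀ v → v ∈ ⊤ → ∣ ⊤ ∩ neighbours (B k) v ∣ ≡ d
    ⊤-regular v v∈⊤ = trans (cong ∣_∣ (closed⇒∩-neighbours (B k) (λ _ _ → ∈⊤) v∈⊤))
      (≤-antisym (degree≤ (B k) (B-admissible 2≤k) v) (B-degree≥ k v))
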